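{- Let $b$ be an integer other than $0$, $-1$, and $-2$. Then $\mathbb{Q}(\alpha) \neq \mathbb{Q}(\beta)$ holds for all $\alpha, \beta \in I_b^{2,r}$ with $\alpha \neq \beta$.
   Context: For an integer $n$ with $n \ge 1$ or $n \le -3$, the set $I_n^{2,r}$ of real numbers is defined by $$I_n^{2,r} := \{\alpha \in (0,1) \mid \alpha^2+n\alpha+c=0 \text{ for some } c \in \mathbb{Z},\ -n \le c \le -1\} \quad \text{if } n \ge 1,$$ $$I_n^{2,r} := \{\alpha \in (0,1) \mid \alpha^2+n\alpha+c=0 \text{ for some } c \in \mathbb{Z},\ 1 \le c \le -n-2\} \quad \text{if } n \le -3.$$ Here $(0,1)$ is the open unit interval, and $\mathbb{Q}(\alpha)$ denotes the subfield of $\mathbb{C}$ generated by $\alpha$. -}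

module Defs where

open import Level using (0ℓ)
open import Data.Nat.Base as ℕ using (ℕ)
import Data.Nat.Properties as ℕₚ
open import Data.Integer.Base as ℤ using (ℤ; 1ℤ; -1ℤ; -[1+_])
open import Data.Rational.Base
  using (ℚ; 0ℚ; 1ℚ; ½; 1/_; _/_; _+_; _-_; _*_; -_; _<_; _≤_; ∣_∣; Positive; NonZero; positive)
import Data.Rational.Properties as ℚₚ
open import Data.Rational.Solver using (module +-*-Solver)
open import Data.Product.Base using (Σ-syntax; ∃-syntax; _×_; _,_)
open import Relation.Binary.PropositionalEquality using (_≡_; refl; sym; trans; cong; cong₂; subst)
open import Relation.Unary using (Pred)

Cauchy : (ℕ → ℚ) → Set
Cauchy x = ∀ ε → 0ℚ < ε → ∃[ N ] ∀ m n → N ℕ.≤ m → N ℕ.≤ n → ∣ x m - x n ∣ < ε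

-- Equality of reals is _≈ℝ_ below, not _≡_.
record ℝ : Set where
  constructor mkℝ
  field
    seq    : ℕ → ℚ
    cauchy : Cauchy seq

open ℝ public

infix  4 _≈ℝ_ _<ℝ_
infixl 6 _+ℝ_
infixl 7 _*ℝ_
infix  8 -ℝ_

_≈ℝ_ : ℝ → ℝ → Set
x ≈ℝ y = ∀ ε → 0ℚ < ε → ∃[ N ] ∀ n → N ℕ.≤ n → ∣ seq x n - seq y n ∣ < ε

-- Termwise strict inequality would not respect _≈ℝ_; a uniform positive gap is
-- required.
_<ℝ_ : ℝ → ℝ → Set
x <ℝ y = Σ[ ε ∈ ℚ ] 0ℚ < ε × (∃[ N ] ∀ n → N ℕ.≤ n → seq x n + ε ≤ seq y n)

module CauchyProperties where
  triangle : ∀ p q → ∣ p ∣ ≤ ∣ p - q ∣ + ∣ q ∣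
  triangle p q = subst (λ r → ∣ r ∣ ≤ ∣ p - q ∣ + ∣ q ∣)
    (solve 2 (λ p q → (p :- q) :+ q := p) refl p q) (ℚₚ.∣p+q∣≤∣p∣+∣q∣ (p - q) q)
    where open +-*-Solver

  half : ∀ {ε} → 0ℚ < ε → 0ℚ < ½ * ε
  half {ε} ε>0 = ℚₚ.positive⁻¹ (½ * ε)
    {{ℚₚ.pos*pos⇒pos ½ ε {{positive ε>0}}}}

  half+half : ∀ ε → ½ * ε + ½ * ε ≡ ε
  half+half = solve 1 (λ ε → con ½ :* ε :+ con ½ :* ε := ε) refl
    where open +-*-Solver

  +-cauchy : ∀ x y → Cauchy x → Cauchy y → Cauchy (λ n → x n + y n)
  +-cauchy x y cx cy ε ε>0 with cx (½ * ε) (half ε>0) | cy (½ * ε) (half ε>0)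
  ... | M , hx | N , hy = M ℕ.⊔ N , λ m n le₁ le₂ → begin-strict
    ∣ (x m + y m) - (x n + y n) ∣
      ≡⟨ cong ∣_∣ (solve 4 (λ a b c d → (a :+ b) :- (c :+ d) := (a :- c) :+ (b :- d))
           refl (x m) (y m) (x n) (y n)) ⟩
    ∣ (x m - x n) + (y m - y n) ∣
      ≤⟨ ℚₚ.∣p+q∣≤∣p∣+∣q∣ (x m - x n) (y m - y n) ⟩
    ∣ x m - x n ∣ + ∣ y m - y n ∣
      <⟨ ℚₚ.+-mono-<
           (hx m n (ℕₚ.m⊔n≤o⇒m≤o M N le₁) (ℕₚ.m⊔n≤o⇒m≤o M N le₂))
           (hy m n (ℕₚ.m⊔n≤o⇒n≤o M N le₁) (ℕₚ.m⊔n≤o⇒n≤o M N le₂)) ⟩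
    ½ * ε + ½ * ε
      ≡⟨ half+half ε ⟩
    ε ∎
    where open +-*-Solver
          open ℚₚ.≤-Reasoning

  neg-cauchy : ∀ x → Cauchy x → Cauchy (λ n → - x n)
  neg-cauchy x cx ε ε>0 with cx ε ε>0
  ... | N , h = N , λ m n le₁ le₂ → subst (λ r → ∣ r ∣ < ε)
    (solve 2 (λ a b → b :- a := (:- a) :- (:- b)) refl (x m) (x n)) (h n m le₂ le₁)
    where open +-*-Solver

  bounded : ∀ x → Cauchy x → Σ[ B ∈ ℚ ] Positive B × (∃[ N ] ∀ n → N ℕ.≤ n → ∣ x n ∣ ≤ B)
  bounded x cx with cx 1ℚ (ℚₚ.positive⁻¹ 1ℚ)
  ... | N , h = 1ℚ + ∣ x N ∣
              , ℚₚ.pos+nonNeg⇒pos 1ℚ ∣ x N ∣ {{ℚₚ.∣-∣-nonNeg (x N)}}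
              , N , λ n le → ℚₚ.≤-trans (triangle (x n) (x N))
                  (ℚₚ.+-monoˡ-≤ ∣ x N ∣ (ℚₚ.<⇒≤ (h n N le ℕₚ.≤-refl)))

  *-difference : ∀ a b c d → a * b - c * d ≡ a * (b - d) + (a - c) * d
  *-difference = solve 4 (λ a b c d → a :* b :- c :* d := a :* (b :- d) :+ (a :- c) :* d) refl
    where open +-*-Solver

  factor : ∀ a b e i → a * (e * i) + (e * i) * b ≡ e * ((a + b) * i)
  factor = solve 4 (λ a b e i → a :* (e :* i) :+ (e :* i) :* b := e :* ((a :+ b) :* i)) refl
    where open +-*-Solver

  split : ∀ A B ε → Positive A → Positive B → 0ℚ < ε →
          Σ[ δ ∈ ℚ ] 0ℚ < δ × A * δ + δ * B ≡ ε
  split A B ε A>0 B>0 ε>0 = ε * r , δ>0 , eq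
    where
    instance
      C-pos : Positive (A + B)
      C-pos = ℚₚ.pos+pos⇒pos A {{A>0}} B {{B>0}}
      C-nonZero : NonZero (A + B)
      C-nonZero = ℚₚ.pos⇒nonZero (A + B)
    r : ℚ
    r = 1/ (A + B)
    δ>0 : 0ℚ < ε * r
    δ>0 = ℚₚ.positive⁻¹ (ε * r)
      {{ℚₚ.pos*pos⇒pos ε {{positive ε>0}} r {{ℚₚ.1/pos⇒pos (A + B)}}}}
    eq : A * (ε * r) + (ε * r) * B ≡ ε
    eq = trans (factor A B ε r) (trans (cong (ε *_) (ℚₚ.*-inverseʳ (A + B))) (ℚₚ.*-identityʳ ε))

  product-estimate : ∀ A B δ → Positive A → Positive B → ∀ a b c d →
    ∣ a ∣ ≤ A → ∣ d ∣ ≤ B → ∣ a - c ∣ < δ → ∣ b - d ∣ < δ →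
    ∣ a * b - c * d ∣ < A * δ + δ * B
  product-estimate A B δ A>0 B>0 a b c d a≤A d≤B ac bd = begin-strict
    ∣ a * b - c * d ∣
      ≡⟨ cong ∣_∣ (*-difference a b c d) ⟩
    ∣ a * (b - d) + (a - c) * d ∣
      ≤⟨ ℚₚ.∣p+q∣≤∣p∣+∣q∣ (a * (b - d)) ((a - c) * d) ⟩
    ∣ a * (b - d) ∣ + ∣ (a - c) * d ∣
      ≡⟨ cong₂ _+_ (ℚₚ.∣p*q∣≡∣p∣*∣q∣ a (b - d)) (ℚₚ.∣p*q∣≡∣p∣*∣q∣ (a - c) d) ⟩
    ∣ a ∣ * ∣ b - d ∣ + ∣ a - c ∣ * ∣ d ∣
      ≤⟨ ℚₚ.+-mono-≤
           (ℚₚ.*-monoʳ-≤-nonNeg ∣ b - d ∣ {{ℚₚ.∣-∣-nonNeg (b - d)}} a≤A)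
           (ℚₚ.*-monoˡ-≤-nonNeg ∣ a - c ∣ {{ℚₚ.∣-∣-nonNeg (a - c)}} d≤B) ⟩
    A * ∣ b - d ∣ + ∣ a - c ∣ * B
      <⟨ ℚₚ.+-mono-< (ℚₚ.*-monoʳ-<-pos A {{A>0}} bd) (ℚₚ.*-monoˡ-<-pos B {{B>0}} ac) ⟩
    A * δ + δ * B ∎
    where open ℚₚ.≤-Reasoning

  *-cauchy : ∀ x y → Cauchy x → Cauchy y → Cauchy (λ n → x n * y n)
  *-cauchy x y cx cy ε ε>0 =
    let A , A>0 , K , hA = bounded x cx
        B , B>0 , L , hB = bounded y cy
        δ , δ>0 , eq     = split A B ε A>0 B>0 ε>0
        M , hx           = cx δ δ>0
        N , hy           = cy δ δ>0
    in (K ℕ.⊔ L) ℕ.⊔ (M ℕ.⊔ N) , λ m n le₁ le₂ →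
      let KL≤m = ℕₚ.m⊔n≤o⇒m≤o (K ℕ.⊔ L) (M ℕ.⊔ N) le₁
          KL≤n = ℕₚ.m⊔n≤o⇒m≤o (K ℕ.⊔ L) (M ℕ.⊔ N) le₂
          MN≤m = ℕₚ.m⊔n≤o⇒n≤o (K ℕ.⊔ L) (M ℕ.⊔ N) le₁
          MN≤n = ℕₚ.m⊔n≤o⇒n≤o (K ℕ.⊔ L) (M ℕ.⊔ N) le₂
      in subst (∣ x m * y m - x n * y n ∣ <_) eq
           (product-estimate A B δ A>0 B>0 (x m) (y m) (x n) (y n)
             (hA m (ℕₚ.m⊔n≤o⇒m≤o K L KL≤m))
             (hB n (ℕₚ.m⊔n≤o⇒n≤o K L KL≤n))
             (hx m n (ℕₚ.m⊔n≤o⇒m≤o M N MN≤m) (ℕₚ.m⊔n≤o⇒m≤o M N MN≤n))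
             (hy m n (ℕₚ.m⊔n≤o⇒n≤o M N MN≤m) (ℕₚ.m⊔n≤o⇒n≤o M N MN≤n)))

open CauchyProperties

_+ℝ_ : ℝ → ℝ → ℝ
x +ℝ y = mkℝ (λ n → seq x n + seq y n) (+-cauchy (seq x) (seq y) (cauchy x) (cauchy y))

-ℝ_ : ℝ → ℝ
-ℝ x = mkℝ (λ n → - seq x n) (neg-cauchy (seq x) (cauchy x))

_*ℝ_ : ℝ → ℝ → ℝ
x *ℝ y = mkℝ (λ n → seq x n * seq y n) (*-cauchy (seq x) (seq y) (cauchy x) (cauchy y))

fromℚ : ℚ → ℝ
fromℚ q = mkℝ (λ _ → q) λ ε ε>0 → 0 , λ _ _ _ _ →
  subst (λ r → ∣ r ∣ < ε) (sym (ℚₚ.+-inverseʳ q)) ε>0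

fromℤ : ℤ → ℝ
fromℤ i = fromℚ (i / 1)

0ℝ 1ℝ : ℝ
0ℝ = fromℚ 0ℚ
1ℝ = fromℚ 1ℚ

record ℂ : Set where
  constructor _+i_
  field
    re im : ℝ

open ℂ public

infix  4 _≈ℂ_
infix  5 _+i_
infixl 6 _+ℂ_
infixl 7 _*ℂ_
infix  8 -ℂ_

_≈ℂ_ : ℂ → ℂ → Set
z ≈ℂ w = re z ≈ℝ re w × im z ≈ℝ im w

_+ℂ_ : ℂ → ℂ → ℂ
z +ℂ w = (re z +ℝ re w) +i (im z +ℝ im w)

-ℂ_ : ℂ → ℂ
-ℂ z = (-ℝ re z) +i (-ℝ im z)

_*ℂ_ : ℂ → ℂ → ℂ
z *ℂ w = (re z *ℝ re w +ℝ -ℝ (im z *ℝ im w)) +i (re z *ℝ im w +ℝ im z *ℝ re w)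

fromℝ : ℝ → ℂ
fromℝ x = x +i 0ℝ

1ℂ : ℂ
1ℂ = fromℝ 1ℝ

-- The least subset containing z and closed under the field operations and under
-- equality of complex numbers. Zero arises as 1 + (- 1), and the rationals as
-- quotients of integers. Inverses are expressed relationally: any w with
-- u w = 1 for a member u is itself a member.
data ℚ⟨_⟩ (z : ℂ) : Pred ℂ 0ℓ where
  generator : ℚ⟨ z ⟩ z
  one       : ℚ⟨ z ⟩ 1ℂ
  add       : ∀ {u w} → ℚ⟨ z ⟩ u → ℚ⟨ z ⟩ w → ℚ⟨ z ⟩ (u +ℂ w)
  neg       : ∀ {u} → ℚ⟨ z ⟩ u → ℚ⟨ z ⟩ (-ℂ u)
  mul       : ∀ {u w} → ℚ⟨ z ⟩ u → ℚ⟨ z ⟩ w → ℚ⟨ z ⟩ (u *ℂ w)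
  inv       : ∀ {u w} → ℚ⟨ z ⟩ u → u *ℂ w ≈ℂ 1ℂ → ℚ⟨ z ⟩ w
  resp      : ∀ {u w} → u ≈ℂ w → ℚ⟨ z ⟩ u → ℚ⟨ z ⟩ w

InUnitInterval : Pred ℝ 0ℓ
InUnitInterval α = 0ℝ <ℝ α × α <ℝ 1ℝ

IsRoot : ℤ → ℤ → Pred ℝ 0ℓ
IsRoot n c α = α *ℝ α +ℝ fromℤ n *ℝ α +ℝ fromℤ c ≈ℝ 0ℝ

-- The two constructors are the two cases n ≥ 1 and n ≤ -3 of the definition, so
-- the set is empty for the remaining n, where it is not defined on paper.
data I²ʳ (n : ℤ) : Pred ℝ 0ℓ where
  n≥1  : ∀ {α} → 1ℤ ℤ.≤ n → InUnitInterval α →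
         (∃[ c ] (ℤ.- n ℤ.≤ c × c ℤ.≤ -1ℤ × IsRoot n c α)) → I²ʳ n α
  n≤-3 : ∀ {α} → n ℤ.≤ -[1+ 2 ] → InUnitInterval α →
         (∃[ c ] (1ℤ ℤ.≤ c × c ℤ.≤ ℤ.- n ℤ.- ℤ.+ 2 × IsRoot n c α)) → I²ʳ n α

{-# OPTIONS --safe #-}

-- Let α² + n α + c = 0 and β² + n β + d = 0. If β ∈ ℚ(α), then β = p + q α with p, q
-- rational, and substituting this into the equation of β forces p = n (q - 1) / 2,
-- because α is irrational. Hence (β - α)² = (q - 1)² (n² / 4 - c) is rational. It is
-- also a root of T² - (n² - 2c - 2d) T + (c - d)², hence an integer. But α ≠ β in
-- the unit interval give 0 < (β - α)² < 1.
module Submission where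

open import Defs
import Algebra.Properties.Group as GroupProperties
open import Algebra.Bundles using (AbelianGroup)
open import Data.Integer.Base as ℤ using (ℤ; 0ℤ; -1ℤ; -[1+_]; +_)
import Data.Integer.Properties as ℤₚ
import Data.Integer.Solver as ℤSolver
open import Data.Nat.Base as ℕ using (ℕ; suc)
open import Data.Nat.Coprimality as Coprimality using (Coprime; coprime-divisor)
import Data.Nat.Divisibility as ℕ∣
import Data.Nat.Properties as ℕₚ
open import Data.Product.Base using (∃-syntax; _×_; _,_; proj₁; proj₂)
open import Data.Rational.Base
  using (ℚ; mkℚ; 0ℚ; 1ℚ; ½; 1/_; _/_; _+_; _-_; _*_; -_; _<_; _≤_; *<*; ∣_∣; Positive; NonZero;
         positive; nonNegative; toℚᵘ; ≢-nonZero)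
import Data.Rational.Properties as ℚₚ
open import Data.Rational.Solver using (module +-*-Solver)
open import Data.Rational.Unnormalised.Base as ℚᵘ using (mkℚᵘ; *≡*)
import Data.Rational.Unnormalised.Properties as ℚᵘₚ
open import Data.Sum.Base using (inj₁; inj₂)
open import Relation.Binary.PropositionalEquality
  using (_≡_; _≢_; refl; sym; trans; cong; cong₂; subst; subst₂; module ≡-Reasoning)
open import Relation.Nullary using (¬_; yes; no; contradiction)
open import Relation.Unary using (_∈_; _≐_)

open CauchyProperties using (half; half+half; bounded)

-- The embedding of the integers into the rationals.

ι : ℤ → ℚ
ι i = i / 1

toℚᵘ-ι : ∀ i → toℚᵘ (ι i) ℚᵘ.≃ mkℚᵘ i 0
toℚᵘ-ι i = ℚₚ.toℚᵘ-fromℚᵘ (mkℚᵘ i 0)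

ι-injective : ∀ {i j} → ι i ≡ ι j → i ≡ j
ι-injective {i} {j} eq = subst₂ _≡_ (ℤₚ.*-identityʳ i) (ℤₚ.*-identityʳ j)
  (ℚᵘₚ.drop-*≡* (begin
    mkℚᵘ i 0    ≈⟨ toℚᵘ-ι i ⟨
    toℚᵘ (ι i)  ≡⟨ cong toℚᵘ eq ⟩
    toℚᵘ (ι j)  ≈⟨ toℚᵘ-ι j ⟩
    mkℚᵘ j 0    ∎))
  where open ℚᵘₚ.≃-Reasoning

ι-+ : ∀ i j → ι (i ℤ.+ j) ≡ ι i + ι j
ι-+ i j = ℚₚ.toℚᵘ-injective (begin
  toℚᵘ (ι (i ℤ.+ j))          ≈⟨ toℚᵘ-ι (i ℤ.+ j) ⟩
  mkℚᵘ (i ℤ.+ j) 0            ≈⟨ *≡* (solve 2 (λ i j → (i :+ j) :* con (+ 1)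
                                       := (i :* con (+ 1) :+ j :* con (+ 1)) :* con (+ 1)) refl i j) ⟩
  mkℚᵘ i 0 ℚᵘ.+ mkℚᵘ j 0      ≈⟨ ℚᵘₚ.+-cong (toℚᵘ-ι i) (toℚᵘ-ι j) ⟨
  toℚᵘ (ι i) ℚᵘ.+ toℚᵘ (ι j)  ≈⟨ ℚₚ.toℚᵘ-homo-+ (ι i) (ι j) ⟨
  toℚᵘ (ι i + ι j)            ∎)
  where open ℚᵘₚ.≃-Reasoning
        open ℤSolver.+-*-Solver

ι-* : ∀ i j → ι (i ℤ.* j) ≡ ι i * ι j
ι-* i j = ℚₚ.toℚᵘ-injective (begin
  toℚᵘ (ι (i ℤ.* j))          ≈⟨ toℚᵘ-ι (i ℤ.* j) ⟩
  mkℚᵘ (i ℤ.* j) 0            ≈⟨ ℚᵘₚ.≃-refl ⟩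
  mkℚᵘ i 0 ℚᵘ.* mkℚᵘ j 0      ≈⟨ ℚᵘₚ.*-cong (toℚᵘ-ι i) (toℚᵘ-ι j) ⟨
  toℚᵘ (ι i) ℚᵘ.* toℚᵘ (ι j)  ≈⟨ ℚₚ.toℚᵘ-homo-* (ι i) (ι j) ⟨
  toℚᵘ (ι i * ι j)            ∎)
  where open ℚᵘₚ.≃-Reasoning

ι-neg : ∀ i → ι (ℤ.- i) ≡ - ι i
ι-neg i = inverseˡ-unique (ι (ℤ.- i)) (ι i)
  (trans (sym (ι-+ (ℤ.- i) i)) (cong ι (ℤₚ.+-inverseˡ i)))
  where open GroupProperties ℚₚ.+-0-group using (inverseˡ-unique)

-- Rational roots of monic integer quadratics.

*-denominator : ∀ n d-1 .(c : Coprime ℤ.∣ n ∣ (suc d-1)) → mkℚ n d-1 c * ι (+ suc d-1) ≡ ι n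
*-denominator n d-1 c = ℚₚ.toℚᵘ-injective (begin
  toℚᵘ (mkℚ n d-1 c * ι (+ suc d-1))
    ≈⟨ ℚₚ.toℚᵘ-homo-* (mkℚ n d-1 c) (ι (+ suc d-1)) ⟩
  mkℚᵘ n d-1 ℚᵘ.* toℚᵘ (ι (+ suc d-1))
    ≈⟨ ℚᵘₚ.*-congˡ {mkℚᵘ n d-1} (toℚᵘ-ι (+ suc d-1)) ⟩
  mkℚᵘ n d-1 ℚᵘ.* mkℚᵘ (+ suc d-1) 0
    ≈⟨ *≡* (trans (ℤₚ.*-identityʳ (n ℤ.* + suc d-1))
         (cong (λ k → n ℤ.* + k) (sym (ℕₚ.*-identityʳ (suc d-1))))) ⟩
  mkℚᵘ n 0
    ≈⟨ toℚᵘ-ι n ⟨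
  toℚᵘ (ι n) ∎)
  where open ℚᵘₚ.≃-Reasoning

-- The rational root theorem in degree two: the denominator divides the square of the numerator,
-- hence by coprimality the numerator, and is therefore 1. The representation stores the denominator
-- minus one, so this reads `d-1 ≡ 0`.
monicRoot-denominator : ∀ m k n d-1 .(c : Coprime ℤ.∣ n ∣ (suc d-1)) → let q = mkℚ n d-1 c in
  q * q + ι m * q + ι k ≡ 0ℚ → d-1 ≡ 0
monicRoot-denominator m k n d-1 c root = ℕₚ.suc-injective (coprime (d∣n , ℕ∣.∣-refl))
  where
  d = + suc d-1
  q = mkℚ n d-1 c

  coprime : Coprime ℤ.∣ n ∣ (suc d-1)
  coprime = Coprimality.recompute c

  -- The root equation times d², with the two terms divisible by d grouped so that d ∣ n² can be
  -- read off.
  cleared : n ℤ.* n ℤ.+ (m ℤ.* n ℤ.+ k ℤ.* d) ℤ.* d ≡ 0ℤ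
  cleared = ι-injective (begin
    ι (n ℤ.* n ℤ.+ (m ℤ.* n ℤ.+ k ℤ.* d) ℤ.* d)
      ≡⟨ trans (ι-+ (n ℤ.* n) ((m ℤ.* n ℤ.+ k ℤ.* d) ℤ.* d)) (cong₂ _+_ (ι-* n n)
          (trans (ι-* (m ℤ.* n ℤ.+ k ℤ.* d) d) (cong (_* ι d)
            (trans (ι-+ (m ℤ.* n) (k ℤ.* d)) (cong₂ _+_ (ι-* m n) (ι-* k d)))))) ⟩
    ι n * ι n + (ι m * ι n + ι k * ι d) * ι d
      ≡⟨ cong (λ x → x * x + (ι m * x + ι k * ι d) * ι d) (*-denominator n d-1 c) ⟨
    (q * ι d) * (q * ι d) + (ι m * (q * ι d) + ι k * ι d) * ι d
      ≡⟨ solve 4 (λ q m k d → (q :* d) :* (q :* d) :+ (m :* (q :* d) :+ k :* d) :* d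
           := (q :* q :+ m :* q :+ k) :* (d :* d)) refl q (ι m) (ι k) (ι d) ⟩
    (q * q + ι m * q + ι k) * (ι d * ι d)
      ≡⟨ cong (_* (ι d * ι d)) root ⟩
    0ℚ * (ι d * ι d)
      ≡⟨ ℚₚ.*-zeroˡ (ι d * ι d) ⟩
    0ℚ ∎)
    where open ≡-Reasoning
          open +-*-Solver

  d∣n² : suc d-1 ℕ∣.∣ ℤ.∣ n ∣ ℕ.* ℤ.∣ n ∣
  d∣n² = ℕ∣.divides ℤ.∣ m ℤ.* n ℤ.+ k ℤ.* d ∣ (begin
    ℤ.∣ n ∣ ℕ.* ℤ.∣ n ∣
      ≡⟨ ℤₚ.abs-* n n ⟨
    ℤ.∣ n ℤ.* n ∣
      ≡⟨ cong ℤ.∣_∣ (inverseˡ-unique (n ℤ.* n) ((m ℤ.* n ℤ.+ k ℤ.* d) ℤ.* d) cleared) ⟩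
    ℤ.∣ ℤ.- ((m ℤ.* n ℤ.+ k ℤ.* d) ℤ.* d) ∣
      ≡⟨ ℤₚ.∣-i∣≡∣i∣ ((m ℤ.* n ℤ.+ k ℤ.* d) ℤ.* d) ⟩
    ℤ.∣ (m ℤ.* n ℤ.+ k ℤ.* d) ℤ.* d ∣
      ≡⟨ ℤₚ.abs-* (m ℤ.* n ℤ.+ k ℤ.* d) d ⟩
    ℤ.∣ m ℤ.* n ℤ.+ k ℤ.* d ∣ ℕ.* suc d-1 ∎)
    where open ≡-Reasoning
          open GroupProperties (AbelianGroup.group ℤₚ.+-0-abelianGroup) using (inverseˡ-unique)

  d∣n : suc d-1 ℕ∣.∣ ℤ.∣ n ∣
  d∣n = coprime-divisor (λ (x , y) → coprime (y , x)) d∣n²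

-- Denominator 1 would make `q` an integer strictly between 0 and 1.
unitInterval-denominator : ∀ q → 0ℚ < q → q < 1ℚ → ℚ.denominator-1 q ≢ 0
unitInterval-denominator (mkℚ n _ _) (*<* 0<n) (*<* n<1) refl = ℤₚ.<-irrefl refl (ℤₚ.<-≤-trans
  (subst (ℤ._< + 1) (ℤₚ.*-identityʳ n) n<1)
  (ℤₚ.i<j⇒suc[i]≤j (subst (0ℤ ℤ.<_) (ℤₚ.*-identityʳ n) 0<n)))

noMonicRoot : ∀ m k q → 0ℚ < q → q < 1ℚ → q * q + ι m * q + ι k ≢ 0ℚ
noMonicRoot m k q@(mkℚ n d-1 c) 0<q q<1 root =
  unitInterval-denominator q 0<q q<1 (monicRoot-denominator m k n d-1 c root)

-- Null sequences and limits of rational sequences.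

open +-*-Solver

-- x ≈ℝ y is definitionally Null (λ n → seq x n - seq y n), and the real operations
-- compute termwise, so equations between reals reduce to termwise ring identities
-- exhibiting one null sequence as a combination of others.
Null : (ℕ → ℚ) → Set
Null f = ∀ ε → 0ℚ < ε → ∃[ N ] ∀ n → N ℕ.≤ n → ∣ f n ∣ < ε

infixl 6 _+₀_
infixl 7 _*₀_

null-cong : ∀ {f g : ℕ → ℚ} → (∀ n → f n ≡ g n) → Null f → Null g
null-cong f≗g f₀ ε ε>0 with f₀ ε ε>0
... | N , h = N , λ n le → subst (λ r → ∣ r ∣ < ε) (f≗g n) (h n le)

null-const : ∀ {q} → q ≡ 0ℚ → Null (λ _ → q)
null-const refl ε ε>0 = 0 , λ _ _ → ε>0

_+₀_ : ∀ {f g} → Null f → Null g → Null (λ n → f n + g n)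
_+₀_ {f} {g} f₀ g₀ ε ε>0 with f₀ (½ * ε) (half ε>0) | g₀ (½ * ε) (half ε>0)
... | M , hf | N , hg = M ℕ.⊔ N , λ n le → begin-strict
  ∣ f n + g n ∣       ≤⟨ ℚₚ.∣p+q∣≤∣p∣+∣q∣ (f n) (g n) ⟩
  ∣ f n ∣ + ∣ g n ∣   <⟨ ℚₚ.+-mono-<
                           (hf n (ℕₚ.m⊔n≤o⇒m≤o M N le)) (hg n (ℕₚ.m⊔n≤o⇒n≤o M N le)) ⟩
  ½ * ε + ½ * ε       ≡⟨ half+half ε ⟩
  ε                   ∎
  where open ℚₚ.≤-Reasoning

0<p*q : ∀ {p q} → 0ℚ < p → 0ℚ < q → 0ℚ < p * q
0<p*q {p} {q} 0<p 0<q = ℚₚ.positive⁻¹ (p * q)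
  {{ℚₚ.pos*pos⇒pos p {{positive 0<p}} q {{positive 0<q}}}}

divide : ∀ B ε → Positive B → 0ℚ < ε → ∃[ δ ] 0ℚ < δ × B * δ ≡ ε
divide B ε B>0 ε>0 = i * ε , 0<p*q i>0 ε>0 , (begin
  B * (i * ε)   ≡⟨ ℚₚ.*-assoc B i ε ⟨
  B * i * ε     ≡⟨ cong (_* ε) (ℚₚ.*-inverseʳ B) ⟩
  1ℚ * ε        ≡⟨ ℚₚ.*-identityˡ ε ⟩
  ε             ∎)
  where
  open ≡-Reasoning
  instance
    B-nonZero : NonZero B
    B-nonZero = ℚₚ.pos⇒nonZero B {{B>0}}
  i : ℚ
  i = 1/ B
  i>0 : 0ℚ < i
  i>0 = ℚₚ.positive⁻¹ i {{ℚₚ.1/pos⇒pos B {{B>0}}}}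

product-bound : ∀ B δ → Positive B → ∀ p q → ∣ p ∣ ≤ B → ∣ q ∣ < δ → ∣ p * q ∣ < B * δ
product-bound B δ B>0 p q p≤B q<δ = begin-strict
  ∣ p * q ∣       ≡⟨ ℚₚ.∣p*q∣≡∣p∣*∣q∣ p q ⟩
  ∣ p ∣ * ∣ q ∣   ≤⟨ ℚₚ.*-monoʳ-≤-nonNeg ∣ q ∣ {{ℚₚ.∣-∣-nonNeg q}} p≤B ⟩
  B * ∣ q ∣       <⟨ ℚₚ.*-monoʳ-<-pos B {{B>0}} q<δ ⟩
  B * δ           ∎
  where open ℚₚ.≤-Reasoning

-- The left factor is a real because its Cauchy property supplies the eventual bound `B`; `f` is
-- then taken below ε / B.
_*₀_ : ∀ x {f} → Null f → Null (λ n → seq x n * f n)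
_*₀_ x {f} f₀ ε ε>0 =
  let B , B>0 , M , x≤B = bounded (seq x) (cauchy x)
      δ , δ>0 , Bδ≡ε    = divide B ε B>0 ε>0
      N , f<δ           = f₀ δ δ>0
  in M ℕ.⊔ N , λ n le → subst (∣ seq x n * f n ∣ <_) Bδ≡ε
    (product-bound B δ B>0 (seq x n) (f n)
      (x≤B n (ℕₚ.m⊔n≤o⇒m≤o M N le)) (f<δ n (ℕₚ.m⊔n≤o⇒n≤o M N le)))

p≤∣p∣ : ∀ p → p ≤ ∣ p ∣
p≤∣p∣ p with ℚₚ.≤-total 0ℚ p
... | inj₁ 0≤p = ℚₚ.≤-reflexive (sym (ℚₚ.0≤p⇒∣p∣≡p 0≤p))
... | inj₂ p≤0 = ℚₚ.≤-trans p≤0 (ℚₚ.0≤∣p∣ p)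

p<q⇒0<q-p : ∀ {p q} → p < q → 0ℚ < q - p
p<q⇒0<q-p {p} {q} p<q = subst (_< q - p) (ℚₚ.+-inverseʳ p) (ℚₚ.+-monoˡ-< (- p) p<q)

-- Otherwise `δ - r` would be a positive tolerance that `f n - r` never falls below from `M` on. In
-- this way the uniform gaps of `_<ℝ_` pass to rational limits.
limit-≥ : ∀ (f : ℕ → ℚ) r δ N → (∀ n → N ℕ.≤ n → δ ≤ f n) → Null (λ n → f n - r) → δ ≤ r
limit-≥ f r δ M δ≤f f→r = ℚₚ.≮⇒≥ λ r<δ →
  let N , h = f→r (δ - r) (p<q⇒0<q-p r<δ)
      n = M ℕ.⊔ N
  in ℚₚ.<-irrefl refl (begin-strict
    f n - r      ≤⟨ p≤∣p∣ (f n - r) ⟩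
    ∣ f n - r ∣  <⟨ h n (ℕₚ.m≤n⊔m M N) ⟩
    δ - r        ≤⟨ ℚₚ.+-monoˡ-≤ (- r) (δ≤f n (ℕₚ.m≤m⊔n M N)) ⟩
    f n - r      ∎)
  where open ℚₚ.≤-Reasoning

const-null : ∀ {q} → Null (λ _ → q) → q ≡ 0ℚ
const-null {q} q₀ = ℚₚ.≤-antisym
  (limit-≥ (λ _ → q) 0ℚ q 0 (λ _ _ → ℚₚ.≤-refl)
    (null-cong (λ _ → sym (ℚₚ.+-identityʳ q)) q₀))
  (limit-≥ (λ _ → 0ℚ) q 0ℚ 0 (λ _ _ → ℚₚ.≤-refl)
    (null-cong (λ _ → solve 1 (λ q → con (- 1ℚ) :* q := con 0ℚ :- q) refl q)
      (fromℚ (- 1ℚ) *₀ q₀)))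

∣p∣²≡p² : ∀ p → ∣ p ∣ * ∣ p ∣ ≡ p * p
∣p∣²≡p² p with ℚₚ.∣p∣≡p∨∣p∣≡-p p
... | inj₁ eq = cong₂ _*_ eq eq
... | inj₂ eq = trans (cong₂ _*_ eq eq) (solve 1 (λ p → :- p :* :- p := p :* p) refl p)

-- If ∣ f n ∣ ≥ ε, then f n² - r ≥ ε² because - r ≥ 0, so the tolerance ε² suffices. This later
-- turns α ≉ β into positivity of the limit of (β - α)².
null-sqrt : ∀ {f : ℕ → ℚ} {r} → r ≤ 0ℚ → Null (λ n → f n * f n - r) → Null f
null-sqrt {f} {r} r≤0 f²→r ε ε>0 with f²→r (ε * ε) (0<p*q ε>0 ε>0)
... | N , h = N , λ n le → ℚₚ.≰⇒> λ ε≤∣f∣ → ℚₚ.<-irrefl refl (begin-strict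
  ε * ε                ≤⟨ ℚₚ.*-monoʳ-≤-nonNeg ε {{ℚₚ.pos⇒nonNeg ε {{positive ε>0}}}} ε≤∣f∣ ⟩
  ∣ f n ∣ * ε          ≤⟨ ℚₚ.*-monoˡ-≤-nonNeg ∣ f n ∣ {{ℚₚ.∣-∣-nonNeg (f n)}} ε≤∣f∣ ⟩
  ∣ f n ∣ * ∣ f n ∣    ≡⟨ ∣p∣²≡p² (f n) ⟩
  f n * f n            ≡⟨ ℚₚ.+-identityʳ (f n * f n) ⟨
  f n * f n - 0ℚ       ≤⟨ ℚₚ.+-monoʳ-≤ (f n * f n) (ℚₚ.neg-antimono-≤ r≤0) ⟩
  f n * f n - r        ≤⟨ p≤∣p∣ (f n * f n - r) ⟩
  ∣ f n * f n - r ∣    <⟨ h n le ⟩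
  ε * ε                ∎)
  where open ℚₚ.≤-Reasoning

-- The field generated by an irrational root of a rational quadratic.

module QuadraticExtension (α : ℝ) (b c : ℚ)
  (root : Null (λ k → seq α k * seq α k + b * seq α k + c))
  (irrational : ∀ r → ¬ Null (λ k → seq α k - r)) where

  private
    a : ℕ → ℚ
    a = seq α

  -- For q ≠ 0, scaling by 1 / q would make α the rational number - p / q. The case split is
  -- constructive since equality of rationals is decidable.
  independent : ∀ p q → Null (λ k → p + q * a k) → p ≡ 0ℚ × q ≡ 0ℚ
  independent p q p+qα₀ with q ℚₚ.≟ 0ℚ
  ... | yes refl = const-null (null-cong
    (λ k → solve 2 (λ p a → p :+ con 0ℚ :* a := p) refl p (a k)) p+qα₀) , refl
  ... | no q≢0 = contradiction
    (null-cong (λ k → solve 4 (λ p q i a →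
        i :* (p :+ q :* a) :+ a :* (con 1ℚ :- i :* q) := a :- (:- (i :* p)))
      refl p q i (a k))
      (fromℚ i *₀ p+qα₀ +₀ α *₀ null-const 1-iq≡0))
    (irrational (- (i * p)))
    where
    instance
      q-nonZero : NonZero q
      q-nonZero = ≢-nonZero q≢0
    i = 1/ q
    1-iq≡0 : 1ℚ - i * q ≡ 0ℚ
    1-iq≡0 = trans (cong (λ x → 1ℚ - x) (ℚₚ.*-inverseˡ q)) (ℚₚ.+-inverseʳ 1ℚ)

  line : ℚ → ℚ → ℝ
  line p q = fromℚ p +ℝ fromℚ q *ℝ α

  InSpan : ℂ → Set
  InSpan z = ∃[ p ] ∃[ q ] (re z ≈ℝ line p q) × Null (seq (im z))

  -- The field norm: by the equation of α, it is the product of p + q α and its conjugate.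
  norm : ℚ → ℚ → ℚ
  norm p q = p * p - b * p * q + c * q * q

  -- The other root of x² + b x + c is - b - α, so conj p q = p + q (- b - α).
  conj : ℚ → ℚ → ℝ
  conj p q = line (p - b * q) (- q)

  -- The coefficients come from expanding the product of two lines and reducing by α² = - b α - c.
  -- The multiple of `root` performs this reduction, and the product of the imaginary parts is null.
  span-mul : ∀ {z w} → InSpan z → InSpan w → InSpan (z *ℂ w)
  span-mul {z} {w} (p , q , z≈ , z-im) (p' , q' , w≈ , w-im) =
    (p * p' - c * q * q') , (p * q' + p' * q - b * q * q')
    , null-cong (λ k → solve 11 (λ u s v t p q p' q' a b c →
          s :* (u :- (p :+ q :* a)) :+ (p :+ q :* a) :* (s :- (p' :+ q' :* a)) :+ (:- t) :* v
            :+ (q :* q') :* (a :* a :+ b :* a :+ c)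
          := (u :* s :+ (:- (v :* t)))
            :- ((p :* p' :- c :* q :* q') :+ (p :* q' :+ p' :* q :- b :* q :* q') :* a))
        refl (seq (re z) k) (seq (re w) k) (seq (im z) k) (seq (im w) k) p q p' q' (a k) b c)
        (re w *₀ z≈ +₀ line p q *₀ w≈ +₀ (-ℝ im w) *₀ z-im +₀ fromℚ (q * q') *₀ root)
    , null-cong (λ k → solve 4 (λ u s v t → u :* t :+ s :* v := u :* t :+ v :* s)
        refl (seq (re z) k) (seq (re w) k) (seq (im z) k) (seq (im w) k))
        (re z *₀ w-im +₀ re w *₀ z-im)

  -- Up to null sequences z is the real number p + q α, so z w ≈ 1 splits into one condition on
  -- `re w` and, in `line*im`, one on `im w`.
  line*re : ∀ z w p q → re z ≈ℝ line p q → Null (seq (im z)) → re (z *ℂ w) ≈ℝ 1ℝ →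
    Null (λ k → (p + q * a k) * seq (re w) k - 1ℚ)
  line*re z w p q z≈ z-im zw≈1 = null-cong (λ k → solve 5 (λ r u v W Z →
      (u :* W :+ (:- (v :* Z)) :- con 1ℚ) :+ Z :* v :+ (:- W) :* (u :- r) := r :* W :- con 1ℚ)
    refl (p + q * a k) (seq (re z) k) (seq (im z) k) (seq (re w) k) (seq (im w) k))
    (zw≈1 +₀ im w *₀ z-im +₀ (-ℝ re w) *₀ z≈)

  line*im : ∀ z w p q → re z ≈ℝ line p q → Null (seq (im z)) → im (z *ℂ w) ≈ℝ 0ℝ →
    Null (λ k → (p + q * a k) * seq (im w) k)
  line*im z w p q z≈ z-im zw≈0 = null-cong (λ k → solve 5 (λ r u v W Z →
      (u :* Z :+ v :* W :- con 0ℚ) :+ (:- W) :* v :+ (:- Z) :* (u :- r) := r :* Z)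
    refl (p + q * a k) (seq (re z) k) (seq (im z) k) (seq (re w) k) (seq (im w) k))
    (zw≈0 +₀ (-ℝ re w) *₀ z-im +₀ (-ℝ im w) *₀ z≈)

  -- Here w is any complex number with z w ≈ 1, so it has to be identified: multiplying by the
  -- conjugate of z gives norm · w ≈ conjugate, and the norm is a rational that can be compared with
  -- 0.
  span-inv : ∀ {z w} → InSpan z → z *ℂ w ≈ℂ 1ℂ → InSpan w
  span-inv {z} {w} (p , q , z≈ , z-im) (zw-re , zw-im) with norm p q ℚₚ.≟ 0ℚ
  -- A zero norm makes the conjugate vanish, so p = q = 0 by independence. Then z is null and z w ≈
  -- 1 would make the constant - 1 null.
  ... | yes N≡0 = contradiction (const-null { - 1ℚ} -1₀) λ ()
    where
    conj₀ : Null (seq (conj p q))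
    conj₀ = null-cong (λ k → solve 6 (λ p q a b c W →
        (:- ((p :- b :* q) :+ (:- q) :* a)) :* ((p :+ q :* a) :* W :- con 1ℚ)
          :+ W :* (p :* p :- b :* p :* q :+ c :* q :* q)
          :+ (:- (q :* q :* W)) :* (a :* a :+ b :* a :+ c)
        := (p :- b :* q) :+ (:- q) :* a)
      refl p q (a k) b c (seq (re w) k))
      ((-ℝ conj p q) *₀ line*re z w p q z≈ z-im zw-re +₀ re w *₀ null-const N≡0
        +₀ (-ℝ (fromℚ (q * q) *ℝ re w)) *₀ root)
    -q≡0 = proj₂ (independent (p - b * q) (- q) conj₀)
    q≡0 : q ≡ 0ℚ
    q≡0 = ℚₚ.neg-injective -q≡0
    p≡0 : p ≡ 0ℚ
    p≡0 = trans (solve 2 (λ p b → p := p :- b :* con 0ℚ) refl p b)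
      (subst (λ q → p - b * q ≡ 0ℚ) q≡0 (proj₁ (independent (p - b * q) (- q) conj₀)))
    -1₀ : Null (λ _ → - 1ℚ)
    -1₀ = null-cong (λ k → trans
        (cong₂ (λ p q → (p + q * a k) * seq (re w) k - 1ℚ) p≡0 q≡0)
        (solve 2 (λ a W → (con 0ℚ :+ con 0ℚ :* a) :* W :- con 1ℚ := con (- 1ℚ))
          refl (a k) (seq (re w) k)))
      (line*re z w p q z≈ z-im zw-re)
  -- These are the coefficients of the conjugate divided by the norm. Both identities below rest on
  -- conjugate · line = norm - q² (a² + b a + c).
  ... | no N≢0 = i * (p - b * q) , - (i * q)
    , null-cong (λ k → solve 7 (λ i p q a b c W →
        i :* ((p :- b :* q) :+ (:- q) :* a) :* ((p :+ q :* a) :* W :- con 1ℚ)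
          :+ i :* (q :* q) :* W :* (a :* a :+ b :* a :+ c)
          :+ W :* (con 1ℚ :- i :* (p :* p :- b :* p :* q :+ c :* q :* q))
        := W :- (i :* (p :- b :* q) :+ (:- (i :* q)) :* a))
      refl i p q (a k) b c (seq (re w) k))
      ((fromℚ i *ℝ conj p q) *₀ line*re z w p q z≈ z-im zw-re
        +₀ (fromℚ i *ℝ fromℚ (q * q) *ℝ re w) *₀ root +₀ re w *₀ null-const 1-iN≡0)
    , null-cong (λ k → solve 7 (λ i p q a b c Z →
        i :* ((p :- b :* q) :+ (:- q) :* a) :* ((p :+ q :* a) :* Z)
          :+ i :* (q :* q) :* Z :* (a :* a :+ b :* a :+ c)
          :+ Z :* (con 1ℚ :- i :* (p :* p :- b :* p :* q :+ c :* q :* q))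
        := Z)
      refl i p q (a k) b c (seq (im w) k))
      ((fromℚ i *ℝ conj p q) *₀ line*im z w p q z≈ z-im zw-im
        +₀ (fromℚ i *ℝ fromℚ (q * q) *ℝ im w) *₀ root +₀ im w *₀ null-const 1-iN≡0)
    where
    instance
      N-nonZero : NonZero (norm p q)
      N-nonZero = ≢-nonZero N≢0
    i : ℚ
    i = 1/ norm p q
    1-iN≡0 : 1ℚ - i * norm p q ≡ 0ℚ
    1-iN≡0 = trans (cong (λ x → 1ℚ - x) (ℚₚ.*-inverseˡ (norm p q))) (ℚₚ.+-inverseʳ 1ℚ)

  -- Induction on the generation of the field. Sums and negatives act on coefficients; products and
  -- inverses use the equation of α.
  field⊆span : ∀ {z} → ℚ⟨ fromℝ α ⟩ z → InSpan z
  field⊆span generator = 0ℚ , 1ℚ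
    , null-cong (λ k → solve 1 (λ a → con 0ℚ := a :- (con 0ℚ :+ con 1ℚ :* a)) refl (a k))
        (null-const refl)
    , null-const refl
  field⊆span one = 1ℚ , 0ℚ
    , null-cong (λ k → solve 1 (λ a → con 0ℚ := con 1ℚ :- (con 1ℚ :+ con 0ℚ :* a)) refl (a k))
        (null-const refl)
    , null-const refl
  field⊆span (add {u} {w} u∈ w∈) with field⊆span u∈ | field⊆span w∈
  ... | p , q , u≈ , u-im | p' , q' , w≈ , w-im = p + p' , q + q'
    , null-cong (λ k → solve 7 (λ u w p q p' q' a →
          u :- (p :+ q :* a) :+ (w :- (p' :+ q' :* a)) := u :+ w :- (p :+ p' :+ (q :+ q') :* a))
        refl (seq (re u) k) (seq (re w) k) p q p' q' (a k))
        (u≈ +₀ w≈)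
    , u-im +₀ w-im
  field⊆span (neg {u} u∈) with field⊆span u∈
  ... | p , q , u≈ , u-im = - p , - q
    , null-cong (λ k → solve 4 (λ u p q a →
          con (- 1ℚ) :* (u :- (p :+ q :* a)) := (:- u) :- ((:- p) :+ (:- q) :* a))
        refl (seq (re u) k) p q (a k))
        (fromℚ (- 1ℚ) *₀ u≈)
    , null-cong (λ k → solve 1 (λ v → con (- 1ℚ) :* v := :- v) refl (seq (im u) k))
        (fromℚ (- 1ℚ) *₀ u-im)
  field⊆span (mul {u} {w} u∈ w∈) = span-mul {u} {w} (field⊆span u∈) (field⊆span w∈)
  field⊆span (inv {u} {w} u∈ uw≈1) = span-inv {u} {w} (field⊆span u∈) uw≈1
  field⊆span (resp {u} {w} (re≈ , im≈) u∈) with field⊆span u∈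
  ... | p , q , u≈ , u-im = p , q
    , null-cong (λ k → solve 3 (λ u w l → u :- l :+ con (- 1ℚ) :* (u :- w) := w :- l)
        refl (seq (re u) k) (seq (re w) k) (p + q * a k))
        (u≈ +₀ fromℚ (- 1ℚ) *₀ re≈)
    , null-cong (λ k → solve 2 (λ v y → v :+ con (- 1ℚ) :* (v :- y) := y)
        refl (seq (im u) k) (seq (im w) k))
        (u-im +₀ fromℚ (- 1ℚ) *₀ im≈)

-- Order and cancellation in the rationals.

0<q-p⇒p<q : ∀ {p q} → 0ℚ < q - p → p < q
0<q-p⇒p<q {p} {q} 0<q-p = subst₂ _<_ (ℚₚ.+-identityˡ p)
  (solve 2 (λ p q → q :- p :+ p := q) refl p q) (ℚₚ.+-monoˡ-< p 0<q-p)

p+ε≤q⇒ε≤q-p : ∀ p ε q → p + ε ≤ q → ε ≤ q - p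
p+ε≤q⇒ε≤q-p p ε q le = subst (_≤ q - p)
  (solve 2 (λ p ε → p :+ ε :- p := ε) refl p ε) (ℚₚ.+-monoˡ-≤ (- p) le)

*-mono-≤-pos : ∀ {p p' q q'} → 0ℚ < p → 0ℚ < q → p ≤ p' → q ≤ q' → p * q ≤ p' * q'
*-mono-≤-pos {p} {p'} {q} {q'} 0<p 0<q p≤p' q≤q' = ℚₚ.≤-trans
  (ℚₚ.*-monoʳ-≤-nonNeg q {{nonNegative (ℚₚ.<⇒≤ 0<q)}} p≤p')
  (ℚₚ.*-monoˡ-≤-nonNeg p' {{nonNegative (ℚₚ.≤-trans (ℚₚ.<⇒≤ 0<p) p≤p')}} q≤q')

p*q≡0⇒q≡0 : ∀ p q → p ≢ 0ℚ → p * q ≡ 0ℚ → q ≡ 0ℚ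
p*q≡0⇒q≡0 p q p≢0 pq≡0 = begin
  q               ≡⟨ ℚₚ.*-identityˡ q ⟨
  1ℚ * q          ≡⟨ cong (_* q) (ℚₚ.*-inverseˡ p) ⟨
  1/ p * p * q    ≡⟨ ℚₚ.*-assoc (1/ p) p q ⟩
  1/ p * (p * q)  ≡⟨ cong (1/ p *_) pq≡0 ⟩
  1/ p * 0ℚ       ≡⟨ ℚₚ.*-zeroʳ (1/ p) ⟩
  0ℚ              ∎
  where
  open ≡-Reasoning
  instance
    p-nonZero : NonZero p
    p-nonZero = ≢-nonZero p≢0

-- Roots in the unit interval.

root-null : ∀ n c α → IsRoot n c α → Null (λ k → seq α k * seq α k + ι n * seq α k + ι c)
root-null n c α = null-cong λ k → ℚₚ.+-identityʳ (seq α k * seq α k + ι n * seq α k + ι c)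

-- A rational value r of α would satisfy the same equation, as r² + n r + c differs from its value
-- at α by a multiple of α - r. The gaps of α from 0 and 1 would place r strictly inside (0,1),
-- against `noMonicRoot`.
root-irrational : ∀ n c α → InUnitInterval α → IsRoot n c α → ∀ r → ¬ Null (λ k → seq α k - r)
root-irrational n c α ((ε , ε>0 , M , ε≤α) , (ε' , ε'>0 , M' , α≤1-ε')) root r α→r =
  noMonicRoot n c r 0<r r<1 (const-null (null-cong
    (λ k → solve 4 (λ a r n c →
        a :* a :+ n :* a :+ c :+ (:- (a :+ r :+ n)) :* (a :- r) := r :* r :+ n :* r :+ c)
      refl (seq α k) r (ι n) (ι c))
    (root-null n c α root +₀ (-ℝ (α +ℝ fromℚ r +ℝ fromℚ (ι n))) *₀ α→r)))
  where
  0<r : 0ℚ < r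
  0<r = ℚₚ.<-≤-trans ε>0 (limit-≥ (seq α) r ε M
    (λ k le → subst (_≤ seq α k) (ℚₚ.+-identityˡ ε) (ε≤α k le)) α→r)
  r<1 : r < 1ℚ
  r<1 = 0<q-p⇒p<q (ℚₚ.<-≤-trans ε'>0 (limit-≥ (λ k → 1ℚ - seq α k) (1ℚ - r) ε' M'
    (λ k le → p+ε≤q⇒ε≤q-p (seq α k) ε' 1ℚ (α≤1-ε' k le))
    (null-cong (λ k → solve 2 (λ a r → con (- 1ℚ) :* (a :- r) := con 1ℚ :- a :- (con 1ℚ :- r))
        refl (seq α k) r)
      (fromℚ (- 1ℚ) *₀ α→r))))

-- If r ≤ 0, then β - α would be null. For r < 1, factor 1 - (β - α)² as (1 - (β - α)) (1 - (α - β))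
-- and bound each factor away from 0.
difference²-limit-bounds : ∀ α β r → InUnitInterval α → InUnitInterval β → ¬ (α ≈ℝ β) →
  Null (λ k → (seq β k - seq α k) * (seq β k - seq α k) - r) → 0ℚ < r × r < 1ℚ
difference²-limit-bounds α β r
  ((ε₁ , ε₁>0 , M₁ , ε₁≤α) , (δ₁ , δ₁>0 , N₁ , α≤1-δ₁))
  ((ε₂ , ε₂>0 , M₂ , ε₂≤β) , (δ₂ , δ₂>0 , N₂ , β≤1-δ₂)) α≉β diff²→r = 0<r , r<1
  where
  0<r : 0ℚ < r
  0<r = ℚₚ.≰⇒> λ r≤0 → α≉β (null-cong
    (λ k → solve 2 (λ a b → con (- 1ℚ) :* (b :- a) := a :- b) refl (seq α k) (seq β k))
    (fromℚ (- 1ℚ) *₀ null-sqrt {λ k → seq β k - seq α k} r≤0 diff²→r))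

  gap : ∀ x y ε δ → 0ℚ + ε ≤ x → y + δ ≤ 1ℚ → ε + δ ≤ 1ℚ - (y - x)
  gap x y ε δ ε≤x y≤1-δ = subst₂ _≤_
    (cong (_+ δ) (ℚₚ.+-identityˡ ε))
    (solve 2 (λ x y → x :+ (con 1ℚ :- y) := con 1ℚ :- (y :- x)) refl x y)
    (ℚₚ.+-mono-≤ ε≤x (p+ε≤q⇒ε≤q-p y δ 1ℚ y≤1-δ))

  0<+ : ∀ {p q} → 0ℚ < p → 0ℚ < q → 0ℚ < p + q
  0<+ 0<p 0<q = ℚₚ.+-mono-< 0<p 0<q

  -- 1 - (β - α) = α + (1 - β) pairs the lower gap of α with the upper gap of β; the other factor
  -- pairs the remaining two.
  N = (M₁ ℕ.⊔ N₂) ℕ.⊔ (M₂ ℕ.⊔ N₁)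

  1-diff²-bound : ∀ k → N ℕ.≤ k →
    (ε₁ + δ₂) * (ε₂ + δ₁) ≤ 1ℚ - (seq β k - seq α k) * (seq β k - seq α k)
  1-diff²-bound k le = subst ((ε₁ + δ₂) * (ε₂ + δ₁) ≤_)
    (solve 2 (λ a b → (con 1ℚ :- (b :- a)) :* (con 1ℚ :- (a :- b)) := con 1ℚ :- (b :- a) :* (b :- a))
      refl (seq α k) (seq β k))
    (*-mono-≤-pos (0<+ ε₁>0 δ₂>0) (0<+ ε₂>0 δ₁>0)
      (gap (seq α k) (seq β k) ε₁ δ₂
        (ε₁≤α k (ℕₚ.m⊔n≤o⇒m≤o M₁ N₂ le₁)) (β≤1-δ₂ k (ℕₚ.m⊔n≤o⇒n≤o M₁ N₂ le₁)))
      (gap (seq β k) (seq α k) ε₂ δ₁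
        (ε₂≤β k (ℕₚ.m⊔n≤o⇒m≤o M₂ N₁ le₂)) (α≤1-δ₁ k (ℕₚ.m⊔n≤o⇒n≤o M₂ N₁ le₂))))
    where
    le₁ = ℕₚ.m⊔n≤o⇒m≤o (M₁ ℕ.⊔ N₂) (M₂ ℕ.⊔ N₁) le
    le₂ = ℕₚ.m⊔n≤o⇒n≤o (M₁ ℕ.⊔ N₂) (M₂ ℕ.⊔ N₁) le

  r<1 : r < 1ℚ
  r<1 = 0<q-p⇒p<q (ℚₚ.<-≤-trans (0<p*q (0<+ ε₁>0 δ₂>0) (0<+ ε₂>0 δ₁>0))
    (limit-≥ (λ k → 1ℚ - (seq β k - seq α k) * (seq β k - seq α k)) (1ℚ - r)
      ((ε₁ + δ₂) * (ε₂ + δ₁)) N 1-diff²-bound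
      (null-cong (λ k → solve 2 (λ d r → con (- 1ℚ) :* (d :- r) := con 1ℚ :- d :- (con 1ℚ :- r))
          refl ((seq β k - seq α k) * (seq β k - seq α k)) r)
        (fromℚ (- 1ℚ) *₀ diff²→r))))

-- The squared difference of two roots with the same linear coefficient.

difference²-identity : ∀ n c d p q → p ≡ ½ * n * (q - 1ℚ) → d ≡ c * q * q - p * p - n * p →
  let r = (q - 1ℚ) * (q - 1ℚ) * (½ * n * (½ * n) - c) in
  r * r + (c + c + (d + d) - n * n) * r + (c - d) * (c - d) ≡ 0ℚ
-- Matching the equations eliminates p and d and leaves a polynomial identity in q, n and c.
difference²-identity n c _ _ q refl refl = solve 3 (λ q n c →
  let p = con ½ :* n :* (q :- con 1ℚ)
      d = c :* q :* q :- p :* p :- n :* p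
      r = (q :- con 1ℚ) :* (q :- con 1ℚ) :* (con ½ :* n :* (con ½ :* n) :- c) in
  r :* r :+ (c :+ c :+ (d :+ d) :- n :* n) :* r :+ (c :- d) :* (c :- d) := con 0ℚ)
  refl q n c

module _ (n c d : ℤ) (α β : ℝ)
  (α∈ : InUnitInterval α) (β∈ : InUnitInterval β)
  (α-root : IsRoot n c α) (β-root : IsRoot n d β) where

  open QuadraticExtension α (ι n) (ι c) (root-null n c α α-root) (root-irrational n c α α∈ α-root)

  private
    a b : ℕ → ℚ
    a = seq α
    b = seq β

  -- Substitute β = p + q α into the equation of β and reduce α². By independence both coefficients
  -- vanish; the one of α is q (2 p - n (q - 1)), where q ≠ 0 because β is irrational too.
  span-coefficients : ∀ p q → β ≈ℝ line p q →
    p ≡ ½ * ι n * (q - 1ℚ) × ι d ≡ ι c * q * q - p * p - ι n * p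
  span-coefficients p q β≈ = p≡ , d≡
    where
    coefficients = independent (p * p - ι c * q * q + ι n * p + ι d) (q * (p + p - ι n * (q - 1ℚ)))
      (null-cong (λ k → solve 7 (λ p q n c d a b →
          b :* b :+ n :* b :+ d :+ (:- (b :+ (p :+ q :* a) :+ n)) :* (b :- (p :+ q :* a))
            :+ (:- (q :* q)) :* (a :* a :+ n :* a :+ c)
          := p :* p :- c :* q :* q :+ n :* p :+ d :+ q :* (p :+ p :- n :* (q :- con 1ℚ)) :* a)
        refl p q (ι n) (ι c) (ι d) (a k) (b k))
      (root-null n d β β-root +₀ (-ℝ (β +ℝ line p q +ℝ fromℚ (ι n))) *₀ β≈
        +₀ fromℚ (- (q * q)) *₀ root-null n c α α-root))
    q≢0 : q ≢ 0ℚ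
    q≢0 refl = root-irrational n d β β∈ β-root p (null-cong
      (λ k → solve 3 (λ p a b → b :- (p :+ con 0ℚ :* a) := b :- p) refl p (a k) (b k)) β≈)
    p≡ : p ≡ ½ * ι n * (q - 1ℚ)
    p≡ = begin
      p
        ≡⟨ solve 3 (λ p q n →
               p := con ½ :* n :* (q :- con 1ℚ) :+ con ½ :* (p :+ p :- n :* (q :- con 1ℚ)))
             refl p q (ι n) ⟩
      ½ * ι n * (q - 1ℚ) + ½ * (p + p - ι n * (q - 1ℚ))
        ≡⟨ cong (λ x → ½ * ι n * (q - 1ℚ) + ½ * x)
             (p*q≡0⇒q≡0 q (p + p - ι n * (q - 1ℚ)) q≢0 (proj₂ coefficients)) ⟩
      ½ * ι n * (q - 1ℚ) + ½ * 0ℚ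
        ≡⟨ solve 1 (λ x → x :+ con ½ :* con 0ℚ := x) refl (½ * ι n * (q - 1ℚ)) ⟩
      ½ * ι n * (q - 1ℚ) ∎
      where open ≡-Reasoning
    d≡ : ι d ≡ ι c * q * q - p * p - ι n * p
    d≡ = begin
      ι d
        ≡⟨ solve 5 (λ p q n c d →
               d := p :* p :- c :* q :* q :+ n :* p :+ d :+ (c :* q :* q :- p :* p :- n :* p))
             refl p q (ι n) (ι c) (ι d) ⟩
      p * p - ι c * q * q + ι n * p + ι d + (ι c * q * q - p * p - ι n * p)
        ≡⟨ cong (_+ (ι c * q * q - p * p - ι n * p)) (proj₁ coefficients) ⟩
      0ℚ + (ι c * q * q - p * p - ι n * p)
        ≡⟨ ℚₚ.+-identityˡ (ι c * q * q - p * p - ι n * p) ⟩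
      ι c * q * q - p * p - ι n * p ∎
      where open ≡-Reasoning

  difference² : ℚ → ℚ
  difference² q = (q - 1ℚ) * (q - 1ℚ) * (½ * ι n * (½ * ι n) - ι c)

  -- For this p, β - α = (q - 1) (α + n / 2), and completing the square gives (α + n / 2)² = n² / 4
  -- - c.
  difference²-limit : ∀ q → β ≈ℝ line (½ * ι n * (q - 1ℚ)) q →
    Null (λ k → (b k - a k) * (b k - a k) - difference² q)
  difference²-limit q β≈ = null-cong (λ k → solve 5 (λ q n c a b →
      let p = con ½ :* n :* (q :- con 1ℚ); l = p :+ q :* a in
      (b :- a :+ (l :- a)) :* (b :- l) :+ (q :- con 1ℚ) :* (q :- con 1ℚ) :* (a :* a :+ n :* a :+ c)
      := (b :- a) :* (b :- a) :- (q :- con 1ℚ) :* (q :- con 1ℚ) :* (con ½ :* n :* (con ½ :* n) :- c))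
    refl q (ι n) (ι c) (a k) (b k))
    ((β +ℝ -ℝ α +ℝ (line (½ * ι n * (q - 1ℚ)) q +ℝ -ℝ α)) *₀ β≈
      +₀ fromℚ ((q - 1ℚ) * (q - 1ℚ)) *₀ root-null n c α α-root)

  -- T² + linear T + constant has the roots (β - α)² and (β + α + n)².
  linear constant : ℤ
  linear = c ℤ.+ c ℤ.+ (d ℤ.+ d) ℤ.+ ℤ.- (n ℤ.* n)
  constant = (c ℤ.+ ℤ.- d) ℤ.* (c ℤ.+ ℤ.- d)

  ι-linear : ι linear ≡ ι c + ι c + (ι d + ι d) - ι n * ι n
  ι-linear = trans (ι-+ (c ℤ.+ c ℤ.+ (d ℤ.+ d)) (ℤ.- (n ℤ.* n))) (cong₂ _+_
    (trans (ι-+ (c ℤ.+ c) (d ℤ.+ d)) (cong₂ _+_ (ι-+ c c) (ι-+ d d)))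
    (trans (ι-neg (n ℤ.* n)) (cong -_ (ι-* n n))))

  ι-constant : ι constant ≡ (ι c - ι d) * (ι c - ι d)
  ι-constant = trans (ι-* (c ℤ.+ ℤ.- d) (c ℤ.+ ℤ.- d)) (cong₂ _*_ ι-minus ι-minus)
    where
    ι-minus : ι (c ℤ.+ ℤ.- d) ≡ ι c - ι d
    ι-minus = trans (ι-+ c (ℤ.- d)) (cong (λ x → ι c + x) (ι-neg d))

  difference²-root : ∀ p q → p ≡ ½ * ι n * (q - 1ℚ) → ι d ≡ ι c * q * q - p * p - ι n * p →
    difference² q * difference² q + ι linear * difference² q + ι constant ≡ 0ℚ
  difference²-root p q p≡ d≡ = trans
    (cong₂ (λ x y → difference² q * difference² q + x * difference² q + y) ι-linear ι-constant)
    (difference²-identity (ι n) (ι c) (ι d) p q p≡ d≡)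

  -- If β were in ℚ(α), the rational `difference² q` would be a root in (0,1) of a monic integer
  -- quadratic.
  roots-generate-distinct : ¬ (α ≈ℝ β) → ¬ (ℚ⟨ fromℝ α ⟩ (fromℝ β))
  roots-generate-distinct α≉β β∈ℚα =
    let p , q , β≈ , _ = field⊆span β∈ℚα
        p≡ , d≡        = span-coefficients p q β≈
        0<r , r<1      = difference²-limit-bounds α β (difference² q) α∈ β∈ α≉β
                           (difference²-limit q (subst (λ p → β ≈ℝ line p q) p≡ β≈))
    in noMonicRoot linear constant (difference² q) 0<r r<1 (difference²-root p q p≡ d≡)

I²ʳ-root : ∀ {n α} → α ∈ I²ʳ n → InUnitInterval α × ∃[ c ] IsRoot n c α
I²ʳ-root (n≥1 _ α∈ (c , _ , _ , root))  = α∈ , c , root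
I²ʳ-root (n≤-3 _ α∈ (c , _ , _ , root)) = α∈ , c , root

theorem2 : (b : ℤ) → b ≢ 0ℤ → b ≢ -1ℤ → b ≢ -[1+ 1 ] →
    (α β : ℝ) → α ∈ I²ʳ b → β ∈ I²ʳ b → ¬ (α ≈ℝ β) →
    ¬ (ℚ⟨ fromℝ α ⟩ ≐ ℚ⟨ fromℝ β ⟩)
theorem2 b _ _ _ α β α∈I β∈I α≉β (_ , ℚβ⊆ℚα) with I²ʳ-root α∈I | I²ʳ-root β∈I
... | α∈ , c , α-root | β∈ , d , β-root =
  -- As the generator of ℚ(β), β lies in ℚ(α) by the inclusion.
  roots-generate-distinct b c d α β α∈ β∈ α-root β-root α≉β (ℚβ⊆ℚα generator)
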